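{- Consider a position with finitely many piles of tokens in which every pile has an even number of tokens. Then it is a $\mathcal{P}$-position in Version B, and it is a $\mathcal{P}$-position in Version C.
   Context: Version B and Version C are two-player impartial games. A position consists of finitely many piles of tokens; empty piles are ignored. The players alternate turns, and the last player to move wins (a player with no legal move loses). In Version B, a player on their turn either removes a single token from any one nonempty pile, or removes one token from each (nonempty) pile. In Version C, a player on their turn either removes a single token from any one nonempty pile, or selects two different nonempty piles and removes one token from each of those two. A position is a $\mathcal{P}$-position if the player who is not about to move has a winning strategy, equivalently if none of its options (positions reachable in one move) is a $\mathcal{P}$-position; otherwise it is an $\mathcal{N}$-position. -}

module Defs where

open import Data.List.Base using (List; []; _∷_; map)
open import Data.List.Relation.Unary.Any using (Any)
open import Data.Nat.Base using (ℕ; suc; pred; _<_)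

-- A position lists its pile sizes.  Entries 0 are empty piles; they are
-- ignored in the sense that no move below touches them or counts them.
Position : Set
Position = List ℕ

data RemoveOne : Position → Position → Set where
  here  : ∀ {n ps} → RemoveOne (suc n ∷ ps) (n ∷ ps)
  there : ∀ {n ps qs} → RemoveOne ps qs → RemoveOne (n ∷ ps) (n ∷ qs)

-- The two piles are at different places of the list, so they are different
-- piles, though possibly of the same size.
data RemoveTwo : Position → Position → Set where
  here  : ∀ {n ps qs} → RemoveOne ps qs → RemoveTwo (suc n ∷ ps) (n ∷ qs)
  there : ∀ {n ps qs} → RemoveTwo ps qs → RemoveTwo (n ∷ ps) (n ∷ qs)

-- Since pred 0 = 0, map pred takes a token from exactly the nonempty piles.
-- The premise of each says that there is one: without it the position with
-- no tokens would have a move to itself.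
data MoveB : Position → Position → Set where
  one  : ∀ {ps qs} → RemoveOne ps qs → MoveB ps qs
  each : ∀ {ps} → Any (0 <_) ps → MoveB ps (map pred ps)

data MoveC : Position → Position → Set where
  one : ∀ {ps qs} → RemoveOne ps qs → MoveC ps qs
  two : ∀ {ps qs} → RemoveTwo ps qs → MoveC ps qs

-- Normal play, for an impartial game with moves _⟶_.  An element of 𝒫 _⟶_ p
-- is a winning strategy at p for the player who is not about to move, and an
-- element of 𝒩 _⟶_ p one for the player who is.  The definition is inductive,
-- so a strategy wins after finitely many moves; a position without moves is
-- in 𝒫.
module _ {A : Set} (_⟶_ : A → A → Set) where
  mutual
    data 𝒫 (p : A) : Set where
      answer : (∀ q → p ⟶ q → 𝒩 q) → 𝒫 p

    data 𝒩 (p : A) : Set where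
      play : ∀ q → p ⟶ q → 𝒫 q → 𝒩 p

{-# OPTIONS --safe #-}

-- The second player repeats the first player's move.  From even piles the
-- first move leaves every pile it touched odd, hence nonempty, so the same move
-- is available again and restores the evenness of all piles.
module Submission where

open import Defs
open import Data.List.Base using ([]; _∷_; map)
open import Data.List.Relation.Unary.All using (All; []; _∷_)
open import Data.List.Relation.Unary.Any using (Any; here; there)
open import Data.Nat.Base
open import Data.Nat.Divisibility using (_∣_; ∣⇒≤; ∣m+n∣m⇒∣n; ∣-refl)
open import Data.Nat.Induction using (<-wellFounded)
open import Data.Nat.ListAction using (sum)
open import Data.Nat.Properties
open import Data.Product.Base using (_×_; _,_; ∃-syntax)
open import Function.Base using (flip)
open import Induction.WellFounded using (WellFounded; Acc; acc; module Subrelation)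
open import Relation.Binary.Construct.On as On using ()

module _ {A : Set} {_⟶_ : A → A → Set} (S : A → Set)
         (reply : ∀ {p q} → p ⟶ q → S p → ∃[ r ] q ⟶ r × S r) where

  -- Mutual recursion peels one layer of `Acc` for each move of either player, which gives the
  -- finite strategy that the inductive `𝒫` demands. The `𝒩` half carries `p ⟶ q` and `S p`, because
  -- `reply` depends on the move made and not on `q` alone.
  replies⇒𝒫-acc : ∀ {p} → Acc (flip _⟶_) p → S p → 𝒫 _⟶_ p
  replies⇒𝒩-acc : ∀ {p q} → Acc (flip _⟶_) q → p ⟶ q → S p → 𝒩 _⟶_ q

  replies⇒𝒫-acc (acc rs) s = answer λ q p⟶q → replies⇒𝒩-acc (rs p⟶q) p⟶q s
  replies⇒𝒩-acc (acc rs) p⟶q s with reply p⟶q s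
  ... | r , q⟶r , s′ = play r q⟶r (replies⇒𝒫-acc (rs q⟶r) s′)

  replies⇒𝒫 : WellFounded (flip _⟶_) → ∀ p → S p → 𝒫 _⟶_ p
  replies⇒𝒫 wf p = replies⇒𝒫-acc (wf p)

-- The total number of tokens is the termination measure for both games.
sum-decreasing⇒wellFounded : {_⟶_ : Position → Position → Set} →
                             (∀ {ps qs} → ps ⟶ qs → sum qs < sum ps) →
                             WellFounded (flip _⟶_)
sum-decreasing⇒wellFounded dec =
  Subrelation.wellFounded dec (On.wellFounded sum <-wellFounded)

RemoveOne-sum-< : ∀ {ps qs} → RemoveOne ps qs → sum qs < sum ps
RemoveOne-sum-< here          = ≤-refl
RemoveOne-sum-< (there {n} m) = +-monoʳ-< n (RemoveOne-sum-< m)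

RemoveTwo-sum-< : ∀ {ps qs} → RemoveTwo ps qs → sum qs < sum ps
RemoveTwo-sum-< (here {n} m)  = +-mono-< (n<1+n n) (RemoveOne-sum-< m)
RemoveTwo-sum-< (there {n} m) = +-monoʳ-< n (RemoveTwo-sum-< m)

sum-map-pred-≤ : ∀ ps → sum (map pred ps) ≤ sum ps
sum-map-pred-≤ []       = z≤n
sum-map-pred-≤ (n ∷ ps) = +-mono-≤ pred[n]≤n (sum-map-pred-≤ ps)

sum-map-pred-< : ∀ {ps} → Any (0 <_) ps → sum (map pred ps) < sum ps
-- The piles behind the witness may all be empty, so they give only a weak bound; the witness itself
-- supplies the strict drop.
sum-map-pred-< {suc n ∷ ps} (here _)    = s≤s (+-monoʳ-≤ n (sum-map-pred-≤ ps))
sum-map-pred-< {n ∷ ps}     (there any) = +-mono-≤-< (pred[n]≤n {n}) (sum-map-pred-< any)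

MoveB-sum-< : ∀ {ps qs} → MoveB ps qs → sum qs < sum ps
MoveB-sum-< (one m)    = RemoveOne-sum-< m
MoveB-sum-< (each any) = sum-map-pred-< any

MoveC-sum-< : ∀ {ps qs} → MoveC ps qs → sum qs < sum ps
MoveC-sum-< (one m) = RemoveOne-sum-< m
MoveC-sum-< (two m) = RemoveTwo-sum-< m

-- A positive multiple of 2 is at least 2. This is what makes a repeated move legal.
2∣1+n⇒0<n : ∀ {n} → 2 ∣ suc n → 0 < n
2∣1+n⇒0<n 2∣1+n = s≤s⁻¹ (∣⇒≤ 2∣1+n)

-- The form with `pred` also covers empty piles, which stay at 0 when `each` is played twice.
2∣n⇒2∣n-2 : ∀ {n} → 2 ∣ n → 2 ∣ pred (pred n)
2∣n⇒2∣n-2 {zero}        2∣n = 2∣n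
2∣n⇒2∣n-2 {suc zero}    2∣n with () ← 2∣1+n⇒0<n 2∣n
2∣n⇒2∣n-2 {suc (suc n)} 2∣n = ∣m+n∣m⇒∣n 2∣n ∣-refl

RemoveOne-repeat : ∀ {ps qs} → RemoveOne ps qs → All (2 ∣_) ps →
                   ∃[ rs ] RemoveOne qs rs × All (2 ∣_) rs
-- The pile had a single token, the only size at which the move could not be repeated; evenness
-- excludes it.
RemoveOne-repeat (here {zero})  (e ∷ es) with () ← 2∣1+n⇒0<n e
RemoveOne-repeat (here {suc n}) (e ∷ es) = _ , here , 2∣n⇒2∣n-2 e ∷ es
RemoveOne-repeat (there m)      (e ∷ es) with RemoveOne-repeat m es
... | _ , m′ , es′ = _ , there m′ , e ∷ es′

RemoveTwo-repeat : ∀ {ps qs} → RemoveTwo ps qs → All (2 ∣_) ps →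
                   ∃[ rs ] RemoveTwo qs rs × All (2 ∣_) rs
RemoveTwo-repeat (here {zero} m)  (e ∷ es) with () ← 2∣1+n⇒0<n e
RemoveTwo-repeat (here {suc n} m) (e ∷ es) with RemoveOne-repeat m es
... | _ , m′ , es′ = _ , here m′ , 2∣n⇒2∣n-2 e ∷ es′
RemoveTwo-repeat (there m)        (e ∷ es) with RemoveTwo-repeat m es
... | _ , m′ , es′ = _ , there m′ , e ∷ es′

-- The same pile remains a witness: being even and nonempty, it had at least two tokens.
any-nonempty-map-pred : ∀ {ps} → Any (0 <_) ps → All (2 ∣_) ps → Any (0 <_) (map pred ps)
any-nonempty-map-pred (here {suc n} _) (e ∷ _)  = here (2∣1+n⇒0<n e)
any-nonempty-map-pred (there any)      (_ ∷ es) = there (any-nonempty-map-pred any es)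

all-even-map-pred² : ∀ {ps} → All (2 ∣_) ps → All (2 ∣_) (map pred (map pred ps))
all-even-map-pred² []       = []
all-even-map-pred² (e ∷ es) = 2∣n⇒2∣n-2 e ∷ all-even-map-pred² es

MoveB-repeat : ∀ {ps qs} → MoveB ps qs → All (2 ∣_) ps → ∃[ rs ] MoveB qs rs × All (2 ∣_) rs
MoveB-repeat (one m) es with RemoveOne-repeat m es
... | _ , m′ , es′ = _ , one m′ , es′
MoveB-repeat (each any) es = _ , each (any-nonempty-map-pred any es) , all-even-map-pred² es

MoveC-repeat : ∀ {ps qs} → MoveC ps qs → All (2 ∣_) ps → ∃[ rs ] MoveC qs rs × All (2 ∣_) rs
MoveC-repeat (one m) es with RemoveOne-repeat m es
... | _ , m′ , es′ = _ , one m′ , es′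
MoveC-repeat (two m) es with RemoveTwo-repeat m es
... | _ , m′ , es′ = _ , two m′ , es′

lemma1p1 : (ps : Position) → All (2 ∣_) ps → 𝒫 MoveB ps × 𝒫 MoveC ps
lemma1p1 ps es =
  replies⇒𝒫 (All (2 ∣_)) MoveB-repeat (sum-decreasing⇒wellFounded MoveB-sum-<) ps es ,
  replies⇒𝒫 (All (2 ∣_)) MoveC-repeat (sum-decreasing⇒wellFounded MoveC-sum-<) ps es
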